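{- Let $X$ be a completely metrizable space and suppose that $wt(X) = \aleph_n$ for some $n \in \omega \setminus \{0\}$. Then $\mathfrak{cov}(X) = \mathfrak{par}(X) = \aleph_n$.
   Context: A Polish space is a separable completely metrizable space. The weight $wt(X)$ of a topological space $X$ is the least cardinality of a basis for $X$. For a completely metrizable space $X$, $\mathfrak{cov}(X)$ denotes the smallest cardinality of a family $\mathcal{C}$ of subspaces of $X$, each of which is Polish, with $\bigcup \mathcal{C} = X$; and $\mathfrak{par}(X)$ denotes the smallest cardinality of a partition of $X$ (a family of pairwise disjoint sets with union $X$) into Polish subspaces. -}

module Defs where

open import Level using (Level; _⊔_; Lift; 0ℓ) renaming (suc to lsuc)
open import Data.Nat.Base as ℕ using (ℕ; zero; suc)
open import Data.Product.Base using (Σ-syntax; ∃-syntax; _×_; _,_; proj₁; proj₂)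
open import Data.Rational.Base as ℚ using (ℚ; 0ℚ; 1ℚ)
open import Data.Rational.Properties as ℚₚ using ()
open import Data.Refinement using (Refinement; value)
open import Data.Unit.Polymorphic using (⊤; tt)
open import Function.Base using (_∘_)
open import Function.Bundles using (_↔_; _↣_; _⇔_)
open import Function.Definitions using (Injective)
open import Function.Metric.Structures using (IsGeneralMetric)
open import Induction.WellFounded using (WellFounded)
open import Relation.Binary.Core using (Rel)
open import Relation.Binary.Definitions using (tri<; tri≈; tri>)
open import Relation.Binary.Structures using (IsStrictTotalOrder)
open import Relation.Binary.PropositionalEquality using (_≡_; refl; sym; cong; subst; module ≡-Reasoning)
open import Relation.Nullary using (¬_; contradiction)
open import Relation.Unary using (Pred; _∈_; _∉_; _⊆_; _≐_; _∩_; _≬_; _⊥′_; ⋃; Satisfiable; Universal)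

private
  variable
    ℓ : Level

-- A real number r is represented by its upper Dedekind cut {q ∈ ℚ ∣ r < q}.
-- Under excluded middle one-sided cuts are the usual real numbers.

record ℝ : Set₁ where
  field
    cut       : Pred ℚ 0ℓ
    inhabited : ∃[ q ] q ∈ cut
    proper    : ∃[ q ] q ∉ cut
    upward    : ∀ {p q} → p ℚ.< q → p ∈ cut → q ∈ cut
    rounded   : ∀ {q} → q ∈ cut → ∃[ p ] p ℚ.< q × p ∈ cut

open ℝ public

infix 4 _≈ℝ_ _≤ℝ_ _<ℚ_
infixl 6 _+ℝ_

_≈ℝ_ : Rel ℝ 0ℓ
x ≈ℝ y = cut x ≐ cut y

_≤ℝ_ : Rel ℝ 0ℓ
x ≤ℝ y = cut y ⊆ cut x

_<ℚ_ : ℝ → ℚ → Set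
x <ℚ q = q ∈ cut x

0ℝ : ℝ
0ℝ = record
  { cut       = 0ℚ ℚ.<_
  ; inhabited = 1ℚ , ℚₚ.positive⁻¹ 1ℚ
  ; proper    = 0ℚ , ℚₚ.<-irrefl refl
  ; upward    = λ p<q 0<p → ℚₚ.<-trans 0<p p<q
  ; rounded   = λ 0<q → let (p , 0<p , p<q) = ℚₚ.<-dense 0<q in p , p<q , 0<p
  }

private
  shift : ∀ a b q → a ℚ.+ (b ℚ.+ (q ℚ.- (a ℚ.+ b))) ≡ q
  shift a b q = begin
    a ℚ.+ (b ℚ.+ (q ℚ.- (a ℚ.+ b)))   ≡⟨ ℚₚ.+-assoc a b _ ⟨
    (a ℚ.+ b) ℚ.+ (q ℚ.- (a ℚ.+ b))   ≡⟨ cong ((a ℚ.+ b) ℚ.+_) (ℚₚ.+-comm q _) ⟩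
    (a ℚ.+ b) ℚ.+ (ℚ.- (a ℚ.+ b) ℚ.+ q) ≡⟨ ℚₚ.+-assoc (a ℚ.+ b) _ q ⟨
    ((a ℚ.+ b) ℚ.- (a ℚ.+ b)) ℚ.+ q   ≡⟨ cong (ℚ._+ q) (ℚₚ.+-inverseʳ (a ℚ.+ b)) ⟩
    0ℚ ℚ.+ q                          ≡⟨ ℚₚ.+-identityˡ q ⟩
    q                                 ∎
    where open ≡-Reasoning

  b<shift : ∀ {a b q} → a ℚ.+ b ℚ.< q → b ℚ.< b ℚ.+ (q ℚ.- (a ℚ.+ b))
  b<shift {a} {b} {q} s<q =
    subst (ℚ._< b ℚ.+ (q ℚ.- (a ℚ.+ b))) (ℚₚ.+-identityʳ b)
      (ℚₚ.+-monoʳ-< b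
        (subst (ℚ._< q ℚ.- (a ℚ.+ b)) (ℚₚ.+-inverseʳ (a ℚ.+ b))
          (ℚₚ.+-monoˡ-< (ℚ.- (a ℚ.+ b)) s<q)))

  bounds : ∀ (x : ℝ) {a b} → a ∉ cut x → b ∈ cut x → a ℚ.< b
  bounds x {a} {b} a∉x b∈x with ℚₚ.<-cmp a b
  ... | tri< a<b _ _ = a<b
  ... | tri≈ _ refl _ = contradiction b∈x a∉x
  ... | tri> _ _ b<a = contradiction (upward x b<a b∈x) a∉x

_+ℝ_ : ℝ → ℝ → ℝ
x +ℝ y = record
  { cut       = λ q → ∃[ a ] ∃[ b ] a ∈ cut x × b ∈ cut y × a ℚ.+ b ≡ q
  ; inhabited = let (a , a∈x) = inhabited x; (b , b∈y) = inhabited y in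
                a ℚ.+ b , a , b , a∈x , b∈y , refl
  ; proper    = let (a , a∉x) = proper x; (b , b∉y) = proper y in
                a ℚ.+ b , λ (a′ , b′ , a′∈x , b′∈y , eq) →
                  ℚₚ.<-irrefl (sym eq) (ℚₚ.+-mono-< (bounds x a∉x a′∈x) (bounds y b∉y b′∈y))
  ; upward    = λ { {_} {q} p<q (a , b , a∈x , b∈y , refl) →
                  a , b ℚ.+ (q ℚ.- (a ℚ.+ b)) , a∈x , upward y (b<shift {a} p<q) b∈y , shift a b q }
  ; rounded   = λ { (a , b , a∈x , b∈y , refl) →
                  let (b′ , b′<b , b′∈y) = rounded y b∈y in
                  a ℚ.+ b′ , ℚₚ.+-monoʳ-< a b′<b , a , b′ , a∈x , b′∈y , refl }
  }

record Metric (X : Set ℓ) : Set (ℓ ⊔ lsuc 0ℓ) where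
  field
    d        : X → X → ℝ
    isMetric : IsGeneralMetric _≡_ _≈ℝ_ _≤ℝ_ 0ℝ _+ℝ_ d

module _ {X : Set ℓ} (M : Metric X) where
  open Metric M

  -- Rational ε suffice, ℚ being dense in ℝ.

  Cauchy : (ℕ → X) → Set
  Cauchy s = ∀ ε → 0ℚ ℚ.< ε → ∃[ N ] ∀ m n → N ℕ.≤ m → N ℕ.≤ n → d (s m) (s n) <ℚ ε

  ConvergesTo : (ℕ → X) → X → Set
  ConvergesTo s x = ∀ ε → 0ℚ ℚ.< ε → ∃[ N ] ∀ n → N ℕ.≤ n → d (s n) x <ℚ ε

  IsComplete : Set ℓ
  IsComplete = ∀ s → Cauchy s → ∃[ x ] ConvergesTo s x

  MetricOpen : Pred (Pred X ℓ) ℓ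
  MetricOpen U = ∀ x → x ∈ U → ∃[ ε ] 0ℚ ℚ.< ε × (∀ y → d x y <ℚ ε → y ∈ U)

-- Subsets are predicates up to _≐_, so openness must respect _≐_.
-- The empty set is the union of the empty family.

record Topology (X : Set ℓ) : Set (lsuc (lsuc ℓ)) where
  field
    Open        : Pred (Pred X ℓ) (lsuc ℓ)
    Open-resp-≐ : ∀ {U V} → U ≐ V → Open U → Open V
    Open-⊤      : Open (λ _ → ⊤)
    Open-∩      : ∀ {U V} → Open U → Open V → Open (U ∩ V)
    Open-⋃      : (I : Set ℓ) (U : I → Pred X ℓ) → (∀ i → Open (U i)) → Open (⋃ I U)

open Topology public

-- Membership proofs in Refinement are irrelevant, so the points of
-- Refinement X S are exactly the points of X that lie in S.

subspace : {X : Set ℓ} → Topology X → (S : Pred X ℓ) → Topology (Refinement X S)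
subspace {ℓ} {X} T S = record
  { Open        = λ V → Σ[ U ∈ Pred X ℓ ] Open T U × V ≐ (U ∘ value)
  ; Open-resp-≐ = λ (V⊆W , W⊆V) (U , oU , V⊆U , U⊆V) →
                  U , oU , V⊆U ∘ W⊆V , V⊆W ∘ U⊆V
  ; Open-⊤      = (λ _ → ⊤) , Open-⊤ T , (λ _ → tt) , (λ _ → tt)
  ; Open-∩      = λ (U₁ , oU₁ , V₁⊆U₁ , U₁⊆V₁) (U₂ , oU₂ , V₂⊆U₂ , U₂⊆V₂) →
                  (U₁ ∩ U₂) , Open-∩ T oU₁ oU₂ ,
                  (λ (p , q) → V₁⊆U₁ p , V₂⊆U₂ q) , (λ (p , q) → U₁⊆V₁ p , U₂⊆V₂ q)
  ; Open-⋃      = λ I V o →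
                  ⋃ I (proj₁ ∘ o) , Open-⋃ T I (proj₁ ∘ o) (proj₁ ∘ proj₂ ∘ o) ,
                  (λ (i , p) → i , proj₁ (proj₂ (proj₂ (o i))) p) ,
                  (λ (i , p) → i , proj₂ (proj₂ (proj₂ (o i))) p)
  }

module _ {X : Set ℓ} (T : Topology X) where

  CompletelyMetrizable : Set (lsuc ℓ)
  CompletelyMetrizable =
    Σ[ M ∈ Metric X ] IsComplete M × (∀ U → Open T U ⇔ MetricOpen M U)

  IsDense : Pred X ℓ → Set (lsuc ℓ)
  IsDense D = ∀ U → Open T U → Satisfiable U → D ≬ U

  Separable : Set (lsuc ℓ)
  Separable = Σ[ D ∈ Pred X ℓ ] IsDense D × (Refinement X D ↣ ℕ)

  IsPolish : Set (lsuc ℓ)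
  IsPolish = Separable × CompletelyMetrizable

IsWellOrder : {A : Set ℓ} → Rel A ℓ → Set ℓ
IsWellOrder _<_ = IsStrictTotalOrder _≡_ _<_ × WellFounded _<_

-- The cardinal ℵₙ, as a property of types.  A type has cardinality ℵₙ₊₁ when
-- it carries a well-ordering of order type ωₙ₊₁, the least ordinal that does
-- not inject into a set B of cardinality ℵₙ: the whole order does not inject
-- into B, but each of its proper initial segments does.

HasCardinality-ℵ : ℕ → Set ℓ → Set (lsuc ℓ)
HasCardinality-ℵ {ℓ} zero    A = Lift (lsuc ℓ) (A ↔ ℕ)
HasCardinality-ℵ {ℓ} (suc n) A =
  Σ[ B ∈ Set ℓ ] HasCardinality-ℵ n B × ¬ (A ↣ B) ×
  (Σ[ R ∈ Rel A ℓ ] IsWellOrder R × (∀ a → Refinement A (λ x → R x a) ↣ B))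

module _ {X : Set ℓ} where

  -- A set of subsets of X of cardinality ∣I∣ is a family indexed by I
  -- without repetitions.

  Distinct : {I : Set ℓ} → (I → Pred X ℓ) → Set ℓ
  Distinct = Injective _≡_ _≐_

  -- κ is the smallest cardinality of a set of subsets of X with property P.

  IsLeastCardinality : Set ℓ → (∀ {I : Set ℓ} → (I → Pred X ℓ) → Set (lsuc ℓ)) → Set (lsuc ℓ)
  IsLeastCardinality κ P =
    (Σ[ I ∈ Set ℓ ] (I ↔ κ) × (Σ[ F ∈ (I → Pred X ℓ) ] Distinct F × P F)) ×
    (∀ (I : Set ℓ) (F : I → Pred X ℓ) → Distinct F → P F → κ ↣ I)

module _ {X : Set ℓ} (T : Topology X) where

  IsBasis : {I : Set ℓ} → (I → Pred X ℓ) → Set (lsuc ℓ)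
  IsBasis B = (∀ i → Open T (B i)) ×
              (∀ U → Open T U → ∀ x → x ∈ U → ∃[ i ] x ∈ B i × B i ⊆ U)

  IsPolishCover : {I : Set ℓ} → (I → Pred X ℓ) → Set (lsuc ℓ)
  IsPolishCover {I} F = (∀ i → IsPolish (subspace T (F i))) × Universal (⋃ I F)

  IsPolishPartition : {I : Set ℓ} → (I → Pred X ℓ) → Set (lsuc ℓ)
  IsPolishPartition F = IsPolishCover F × (∀ {i j} → ¬ i ≡ j → F i ⊥′ F j)

  WeightIs : Set ℓ → Set (lsuc ℓ)
  WeightIs κ = IsLeastCardinality κ IsBasis

  CovIs : Set ℓ → Set (lsuc ℓ)
  CovIs κ = IsLeastCardinality κ IsPolishCover

  ParIs : Set ℓ → Set (lsuc ℓ)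
  ParIs κ = IsLeastCardinality κ IsPolishPartition

{-# OPTIONS --safe #-}

-- Lower bound: if a Polish cover were smaller than ℵₙ, then so would be the union of countable dense
-- subsets of its members, hence also a basis made of balls.
--
-- Partition, by induction on n: let y be a dense family indexed by a set of cardinality ℵₙ₊₁, and let
-- Z(a) be the closure of { y k ∣ k < a }.  The Z(a) increase, and they exhaust X because countable
-- subsets of ℵₙ₊₁ are bounded.  So the sets Z(a) ∖ ⋃_{b < a} Z(b) partition X.  Each of them is
-- contained in the closure of at most ℵₙ points, and it is a closed set minus an Fσ: the union
-- ⋃_{b < a} Z(b) is closed unless a has countable cofinality, when it is a countable union.  Iterating
-- down to n = 0 leaves separable pieces of the form closed minus Fσ, which are Polish by Alexandrov.
--
-- Excluded middle decides arbitrary types and so yields choice functions, but these need not respect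
-- _≐_ or pointwise equality of functions; least elements of well-orders are used where that matters.
module Submission where

open import Axiom.ExcludedMiddle using (ExcludedMiddle)
open import Data.Empty using (⊥-elim)
open import Data.Empty.Polymorphic using (⊥)
import Data.Integer.Base as ℤ
import Data.Integer.Properties as ℤₚ
open import Data.Irrelevant using ([_])
open import Data.Nat.Base as ℕ using (ℕ; zero; NonZero)
open import Data.Nat.Coprimality using (1-coprimeTo)
import Data.Nat.Induction as ℕ
import Data.Nat.Properties as ℕₚ
open import Data.Product.Base using (Σ; Σ-syntax; ∃; ∃-syntax; _×_; _,_; proj₁; proj₂)
open import Data.Product.Function.NonDependent.Propositional using (_×-↣_)
open import Data.Product.Relation.Binary.Lex.Strict using (×-Lex; ×-wellFounded; ×-transitive; ×-compare)
open import Data.Rational.Base as ℚ using (ℚ; 0ℚ; 1ℚ; ½; mkℚ; *≤*; *<*; _≤_; _<_; _+_; _*_; _-_; _⊓_)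
import Data.Rational.Properties as ℚₚ
open import Data.Rational.Solver using (module +-*-Solver)
open import Data.Refinement using (Refinement; _,_; value; value-injective)
open import Data.Sum.Base using (_⊎_; inj₁; inj₂; [_,_]′)
open import Data.Unit.Polymorphic using (⊤)
open import Defs
open import Function.Base using (_∘_; _on_; case_of_; id)
open import Function.Bundles using (_↔_; _↣_; mk↣; mk⤖; module Injection; _⇔_; mk⇔; module Equivalence)
open import Function.Construct.Composition using (_↣-∘_)
open import Function.Construct.Identity using (↣-id)
open import Function.Metric.Structures using (IsGeneralMetric)
open import Function.Properties.Bijection using (⤖⇒↔)
open import Function.Properties.Inverse using (↔⇒↣; ↔-sym)
open import Induction.WellFounded as WF using (WellFounded)
open import Level using (Level; suc; Lift; lift; lower)
import Relation.Binary.Construct.On as On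
open import Relation.Binary.Core using (Rel)
open import Relation.Binary.Definitions using (Transitive; Trichotomous; tri<; tri≈; tri>)
open import Relation.Binary.PropositionalEquality using (_≡_; _≢_; refl; sym; trans; cong; cong₂; subst; subst₂; isEquivalence)
open import Relation.Binary.Structures using (IsStrictTotalOrder)
open import Relation.Binary.Structures.Biased using (isStrictTotalOrderᶜ)
open import Relation.Nullary using (¬_; yes; no; contradiction; recompute)
open import Relation.Nullary.Decidable using (decidable-stable; True; toWitness; fromWitness; map′)
open import Relation.Unary using (Pred; Satisfiable; _≐_; _∈_; _∉_; _⊆_; _∩_)

open Injection using (to; injective)

-- Well-orders and infinite cardinals

-- The value at `(m , n)` is 2^m (2n + 1), so parity decides between the clauses.
ℕ-pairing : ℕ × ℕ → ℕ
ℕ-pairing (zero , n) = ℕ.suc (2 ℕ.* n)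
ℕ-pairing (ℕ.suc m , n) = 2 ℕ.* ℕ-pairing (m , n)

ℕ×ℕ↣ℕ : (ℕ × ℕ) ↣ ℕ
ℕ×ℕ↣ℕ = mk↣ (λ {p} {q} → inj p q)
  where
  inj : ∀ p q → ℕ-pairing p ≡ ℕ-pairing q → p ≡ q
  inj (zero , n) (zero , n′) eq = cong (zero ,_) (ℕₚ.*-cancelˡ-≡ n n′ 2 (ℕₚ.suc-injective eq))
  inj (zero , n) (ℕ.suc m′ , n′) eq = contradiction (sym eq) (ℕₚ.even≢odd (ℕ-pairing (m′ , n′)) n)
  inj (ℕ.suc m , n) (zero , n′) eq = contradiction eq (ℕₚ.even≢odd (ℕ-pairing (m , n)) n′)
  inj (ℕ.suc m , n) (ℕ.suc m′ , n′) eq =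
    case inj (m , n) (m′ , n′) (ℕₚ.*-cancelˡ-≡ (ℕ-pairing (m , n)) (ℕ-pairing (m′ , n′)) 2 eq) of λ { refl → refl }

private
  variable
    α β γ : Level
    A : Set α
    B : Set β
    C : Set γ

infixr 8 _∘↣_

_∘↣_ : B ↣ C → A ↣ B → A ↣ C
_∘↣_ = _↣-∘_

Σ-↣ : {J : A → Set β} → A ↣ B → (∀ i → J i ↣ C) → Σ A J ↣ (B × C)
Σ-↣ {J = J} f g = mk↣ {to = code} code-injective
  where
  code : Σ _ J → _
  code (i , j) = to f i , to (g i) j
  code-injective : ∀ {p q} → code p ≡ code q → p ≡ q
  code-injective {i , j} {i′ , j′} eq with refl ← injective f (cong proj₁ eq) =
    cong (i ,_) (injective (g i) (cong proj₂ eq))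

wellOrder : {_<_ : Rel A α} → Transitive _<_ → Trichotomous _≡_ _<_ → WellFounded _<_ → IsWellOrder _<_
wellOrder tr cmp wf = isStrictTotalOrderᶜ
  (record { isEquivalence = isEquivalence ; trans = tr ; compare = cmp }) , wf

pullback : {A B : Set α} {_<_ : Rel B α} (f : A ↣ B) → IsWellOrder _<_ → IsWellOrder (_<_ on to f)
pullback {_<_ = _<_} f (sto , wf) = wellOrder (IsStrictTotalOrder.trans sto) cmp (On.wellFounded (to f) wf)
  where
  cmp : Trichotomous _≡_ (_<_ on to f)
  cmp x y with IsStrictTotalOrder.compare sto (to f x) (to f y)
  ... | tri< l n g = tri< l (n ∘ cong (to f)) g
  ... | tri≈ l e g = tri≈ l (injective f e) g
  ... | tri> l n g = tri> l (n ∘ cong (to f)) g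

ℕ-wellOrder : {A : Set α} (f : A ↣ ℕ) → IsWellOrder (λ x y → Lift α (to f x ℕ.< to f y))
ℕ-wellOrder {α} f = wellOrder
  (λ { (lift p) (lift q) → lift (ℕₚ.<-trans p q) }) cmp
  (WF.Subrelation.wellFounded lower (On.wellFounded (to f) ℕ.<-wellFounded))
  where
  cmp : Trichotomous _≡_ (λ x y → Lift α (to f x ℕ.< to f y))
  cmp x y with ℕₚ.<-cmp (to f x) (to f y)
  ... | tri< l n g = tri< (lift l) (n ∘ cong (to f)) (g ∘ lower)
  ... | tri≈ l e g = tri≈ (l ∘ lower) (injective f e) (g ∘ lower)
  ... | tri> l n g = tri> (l ∘ lower) (n ∘ cong (to f)) (lift g)

module Classical {ℓ : Level} (em : ExcludedMiddle ℓ) where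

  stable : {P : Set ℓ} → ¬ ¬ P → P
  stable = decidable-stable em

  -- Excluded middle decides `P (value x)`, so its proof can be recomputed; the result depends on
  -- `value x` alone and can serve as a choice.
  relevant : {A : Set ℓ} {P : Pred A ℓ} (x : Refinement A P) → P (value x)
  relevant (x , [ p ]) = recompute em p

  restrict-↣ : {A B : Set ℓ} {P : Pred A ℓ} → A ↣ B → Refinement A P ↣ B
  restrict-↣ f = f ∘↣ mk↣ value-injective

  module WellOrdered {A : Set ℓ} {_<_ : Rel A ℓ} (wo : IsWellOrder _<_) where

    open IsStrictTotalOrder (proj₁ wo) public using (compare) renaming (trans to <-trans; irrefl to <-irrefl)

    <-wellFounded : WellFounded _<_
    <-wellFounded = proj₂ wo

    injective-< : {B : Set ℓ} (f : A → B) → (∀ {x y} → x < y → f x ≢ f y) → ∀ {x y} → f x ≡ f y → x ≡ y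
    injective-< f separates {x} {y} eq with compare x y
    ... | tri< x<y _ _ = contradiction eq (separates x<y)
    ... | tri≈ _ x≡y _ = x≡y
    ... | tri> _ _ y<x = contradiction (sym eq) (separates y<x)

    <⇒≯ : ∀ {x y} → x < y → ¬ y < x
    <⇒≯ x<y y<x = <-irrefl refl (<-trans x<y y<x)

    IsLeast : Pred A ℓ → Pred A ℓ
    IsLeast P x = P x × (∀ {y} → y < x → ¬ P y)

    least : (P : Pred A ℓ) → Satisfiable P → ∃ (IsLeast P)
    least P (x , px) = stable λ ¬least →
      WF.All.wfRec <-wellFounded ℓ (λ x → ¬ P x) (λ x ih px → ¬least (x , px , ih)) x px

    -- Two equivalent predicates are allowed because they need not be equal without extensionality.
    least-unique : {P Q : Pred A ℓ} → (∀ {x} → P x → Q x) → (∀ {x} → Q x → P x) →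
                   ∀ {x y} → IsLeast P x → IsLeast Q y → x ≡ y
    least-unique P⊆Q Q⊆P {x} {y} (px , x-min) (qy , y-min) with compare x y
    ... | tri< x<y _ _ = contradiction (P⊆Q px) (y-min x<y)
    ... | tri≈ _ eq _ = eq
    ... | tri> _ _ y<x = contradiction (Q⊆P qy) (x-min y<x)

    module _ {X : Set ℓ} (F : A → Pred X ℓ) where

      -- Restricting the index set to first occurrences removes the repetitions from `F` and keeps
      -- every set that occurs, up to `_≐_`.
      FirstOccurrence : Pred A ℓ
      FirstOccurrence a = ∀ {b} → b < a → ¬ (F b ≐ F a)

      firstOccurrence : ∀ a → ∃[ b ] (F b ≐ F a × FirstOccurrence b)
      firstOccurrence a =
        let (b , Fb≐Fa , minimal) = least (λ b → F b ≐ F a) (a , id , id)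
        in b , Fb≐Fa , λ c<b Fc≐Fb → minimal c<b (proj₁ Fb≐Fa ∘ proj₁ Fc≐Fb , proj₂ Fc≐Fb ∘ proj₂ Fb≐Fa)

      firstOccurrences-distinct : Distinct (F ∘ value {P = FirstOccurrence})
      firstOccurrences-distinct {p} {q} Fp≐Fq with compare (value p) (value q)
      ... | tri< p<q _ _ = contradiction Fp≐Fq (relevant {P = FirstOccurrence} q p<q)
      ... | tri≈ _ p≡q _ = value-injective p≡q
      ... | tri> _ _ q<p = ⊥-elim (relevant {P = FirstOccurrence} p q<p (proj₂ Fp≐Fq , proj₁ Fp≐Fq))

  -- Comparability of well-ordered sets

  module _ {A B : Set ℓ} {_<_ : Rel A ℓ} {_⊏_ : Rel B ℓ} (woA : IsWellOrder _<_) (woB : IsWellOrder _⊏_) where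
    private
      module A = WellOrdered woA
      module B = WellOrdered woB

      module Embed (¬exhausted : ¬ (∃[ a ] (B ↣ Refinement A (_< a)))) where

        -- Values are compared at recomputed proofs of x < a, so that a value hit determines its x.
        Fresh : ∀ a → (∀ {x} → x < a → B) → Pred B ℓ
        Fresh a g y = ∀ (x : Refinement A (_< a)) → g (relevant x) ≢ y

        -- If every `y` were a value of `g`, choosing a preimage of each would inject `B` into the
        -- segment below `a`.
        fresh : ∀ a (g : ∀ {x} → x < a → B) → Satisfiable (Fresh a g)
        fresh a g = stable λ none →
          let hit : ∀ y → Σ[ x ∈ Refinement A (_< a) ] g (relevant x) ≡ y
              hit y = stable λ miss → none (y , λ x eq → miss (x , eq))
          in ¬exhausted (a , mk↣ {to = proj₁ ∘ hit} λ {y} {y′} eq →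
               trans (sym (proj₂ (hit y))) (trans (cong (λ x → g (relevant x)) eq) (proj₂ (hit y′))))

        -- Without function extensionality, the recursion can only be unfolded because
        -- least elements depend extensionally on the values already taken.
        step : ∀ a → (∀ {x} → x < a → B) → B
        step a g = proj₁ (B.least (Fresh a g) (fresh a g))

        step-ext : ∀ a {g h : ∀ {x} → x < a → B} → (∀ {x} (x<a : x < a) → g x<a ≡ h x<a) → step a g ≡ step a h
        step-ext a {g} {h} g≗h = B.least-unique
          (λ p x eq → p x (trans (g≗h _) eq)) (λ p x eq → p x (trans (sym (g≗h _)) eq))
          (proj₂ (B.least (Fresh a g) (fresh a g))) (proj₂ (B.least (Fresh a h) (fresh a h)))

        f : A → B
        f = WF.All.wfRec A.<-wellFounded ℓ (λ _ → B) step

        f-unfold : ∀ a → f a ≡ step a (λ {x} _ → f x)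
        f-unfold a = WF.FixPoint.unfold-wfRec A.<-wellFounded (λ _ → B) step step-ext

        step-fresh : ∀ a (g : ∀ {x} → x < a → B) → Fresh a g (step a g)
        step-fresh a g = proj₁ (proj₂ (B.least (Fresh a g) (fresh a g)))

        f-fresh : ∀ {x a} → x < a → f x ≢ f a
        f-fresh {x} {a} x<a eq = step-fresh a (λ {x} _ → f x) (x , [ x<a ]) (trans eq (f-unfold a))

    -- Sending each `a` to the least value not yet taken fails only if some proper segment already
    -- receives `B`. Having a proper segment in the second alternative bounds `B` whenever the
    -- segments of `A` are small.
    compare-↣ : (A ↣ B) ⊎ (∃[ a ] (B ↣ Refinement A (_< a)))
    compare-↣ with em {P = ∃[ a ] (B ↣ Refinement A (_< a))}
    ... | yes exhausted = inj₂ exhausted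
    ... | no ¬exhausted = inj₁ (mk↣ (A.injective-< (Embed.f ¬exhausted) (Embed.f-fresh ¬exhausted)))

  -- Alephs: squares and boundedness of countable subsets

  record InfiniteCardinal (A : Set ℓ) : Set (suc ℓ) where
    field
      _≺_         : Rel A ℓ
      isWellOrder : IsWellOrder _≺_
      ℕ↣          : ℕ ↣ A
      square      : (A × A) ↣ A
    open WellOrdered isWellOrder public

  ℕ-infiniteCardinal : {A : Set ℓ} → A ↔ ℕ → InfiniteCardinal A
  ℕ-infiniteCardinal A↔ℕ = record
    { isWellOrder = ℕ-wellOrder (↔⇒↣ A↔ℕ)
    ; ℕ↣          = ↔⇒↣ (↔-sym A↔ℕ)
    ; square      = ↔⇒↣ (↔-sym A↔ℕ) ∘↣ ℕ×ℕ↣ℕ ∘↣ (↔⇒↣ A↔ℕ ×-↣ ↔⇒↣ A↔ℕ)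
    }

  module Successor {A B : Set ℓ} (card : InfiniteCardinal B) (A↣̸B : ¬ (A ↣ B))
    {_<_ : Rel A ℓ} (wo : IsWellOrder _<_) (segment : ∀ a → Refinement A (_< a) ↣ B) where

    private
      module B = InfiniteCardinal card
      open WellOrdered wo

    ℕ×B↣B : (ℕ × B) ↣ B
    ℕ×B↣B = B.square ∘↣ (B.ℕ↣ ×-↣ ↣-id B)

    ℕ×ℕ×B↣B : (ℕ × (ℕ × B)) ↣ B
    ℕ×ℕ×B↣B = ℕ×B↣B ∘↣ (↣-id ℕ ×-↣ ℕ×B↣B)

    B↣A : B ↣ A
    B↣A with compare-↣ wo B.isWellOrder
    ... | inj₁ A↣B = contradiction A↣B A↣̸B
    ... | inj₂ (a , f) = mk↣ value-injective ∘↣ f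

    closedSegment : ∀ a → Refinement A (λ x → ¬ a < x) ↣ (ℕ × B)
    closedSegment a = mk↣ {to = code} code-injective
      where
      code : Refinement A (λ x → ¬ a < x) → ℕ × B
      code (x , _) with compare x a
      ... | tri< x<a _ _ = 0 , to (segment a) (x , [ x<a ])
      -- As `a < x` is excluded, this is the point `a` itself; the tag `1` identifies it and the
      -- second component is arbitrary.
      ... | _ = 1 , to B.ℕ↣ 0
      code-injective : ∀ {x y} → code x ≡ code y → x ≡ y
      code-injective {x , [ p ]} {y , [ q ]} eq with compare x a | compare y a
      ... | tri< _ _ _ | tri< _ _ _ = value-injective (cong value (injective (segment a) (cong proj₂ eq)))
      ... | tri≈ _ refl _ | tri≈ _ refl _ = refl
      ... | tri> _ _ a<x | _ = contradiction a<x (recompute em p)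
      ... | _ | tri> _ _ a<y = contradiction a<y (recompute em q)
      ... | tri< _ _ _ | tri≈ _ _ _ = case eq of λ ()
      ... | tri≈ _ _ _ | tri< _ _ _ = case eq of λ ()

    closedSegment-value : ∀ a p q → to (closedSegment a) p ≡ to (closedSegment a) q → value p ≡ value q
    closedSegment-value a p q eq = cong value (injective (closedSegment a) {p} {q} eq)

    _⊏_ : Rel (A × B) ℓ
    _⊏_ = ×-Lex _≡_ _<_ B._≺_

    ⊏-isWellOrder : IsWellOrder _⊏_
    ⊏-isWellOrder = wellOrder
      (×-transitive {_<₂_ = B._≺_} isEquivalence (subst (_ <_) , subst (_< _)) <-trans B.<-trans) cmp
      (×-wellFounded <-wellFounded B.<-wellFounded)
      where
      cmp : Trichotomous _≡_ _⊏_
      cmp p@(a , b) q@(a′ , b′) with ×-compare sym compare B.compare p q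
      ... | tri< l n g = tri< l (λ { refl → n (refl , refl) }) g
      ... | tri≈ l (refl , refl) g = tri≈ l refl g
      ... | tri> l n g = tri> l (λ { refl → n (refl , refl) }) g

    -- A pair below `(a , b)` has first coordinate at most `a`, coded by `closedSegment a`, and its
    -- second coordinate lies in `B` anyway.
    ⊏-segment : ∀ p → Refinement (A × B) (_⊏ p) ↣ B
    ⊏-segment (a , b) = ℕ×B↣B ∘↣ (↣-id ℕ ×-↣ B.square) ∘↣ mk↣ {to = code} code-injective
      where
      ≮ : ∀ {x y} → (x , y) ⊏ (a , b) → ¬ a < x
      ≮ (inj₁ x<a) = <⇒≯ x<a
      ≮ (inj₂ (refl , _)) = <-irrefl refl
      first : Refinement (A × B) (_⊏ (a , b)) → ℕ × B
      first ((x , _) , [ p ]) = to (closedSegment a) (x , [ ≮ p ])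
      code : Refinement (A × B) (_⊏ (a , b)) → ℕ × (B × B)
      code p = proj₁ (first p) , proj₂ (first p) , proj₂ (value p)
      code-injective : ∀ {p q} → code p ≡ code q → p ≡ q
      code-injective {(x , _) , [ p ]} {(x′ , _) , [ p′ ]} eq = value-injective (cong₂ _,_
        (closedSegment-value a (x , [ ≮ p ]) (x′ , [ ≮ p′ ]) (cong₂ _,_ (cong proj₁ eq) (cong (proj₁ ∘ proj₂) eq)))
        (cong (proj₂ ∘ proj₂) eq))

    -- Otherwise `A` would inject into a proper segment of the lexicographic order, and hence into
    -- `B`.
    A×B↣A : (A × B) ↣ A
    A×B↣A with compare-↣ ⊏-isWellOrder wo
    ... | inj₁ f = f
    ... | inj₂ (p , f) = contradiction (⊏-segment p ∘↣ f) A↣̸B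

    -- A pair is coded by its larger coordinate, a tag saying which one that is, and the position of
    -- the other coordinate in the closed segment up to it.
    A×A↣A : (A × A) ↣ A
    A×A↣A = A×B↣A ∘↣ (↣-id A ×-↣ ℕ×ℕ×B↣B) ∘↣ mk↣ {to = code} code-injective
      where
      code : A × A → A × (ℕ × (ℕ × B))
      code (x , y) with em {P = x < y}
      ... | yes x<y = y , 0 , to (closedSegment y) (x , [ <⇒≯ x<y ])
      ... | no x≮y = x , 1 , to (closedSegment x) (y , [ x≮y ])
      code-injective : ∀ {p q} → code p ≡ code q → p ≡ q
      code-injective {x , y} {x′ , y′} eq with em {P = x < y} | em {P = x′ < y′} | eq
      ... | yes _ | no _ | ()
      ... | no _ | yes _ | ()
      ... | yes x<y | yes x′<y′ | e with refl ← cong proj₁ e =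
        cong (_, y) (closedSegment-value y (x , [ <⇒≯ x<y ]) (x′ , [ <⇒≯ x′<y′ ]) (cong (proj₂ ∘ proj₂) e))
      ... | no x≮y | no x′≮y′ | e with refl ← cong proj₁ e =
        cong (x ,_) (closedSegment-value x (y , [ x≮y ]) (y′ , [ x′≮y′ ]) (cong (proj₂ ∘ proj₂) e))

    infiniteCardinal : InfiniteCardinal A
    infiniteCardinal = record { isWellOrder = wo ; ℕ↣ = B↣A ∘↣ B.ℕ↣ ; square = A×A↣A }

    -- If `s` were unbounded, every `a` would lie in the closed segment up to some `s n`; then `n`
    -- and the position of `a` there would inject `A` into `B`.
    bounded : (s : ℕ → A) → ∃[ a ] ∀ n → s n < a
    bounded s = stable λ unbounded →
      let above : ∀ a → ∃[ n ] ¬ (s n < a)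
          above a = stable λ none → unbounded (a , λ n → stable λ s≮a → none (n , s≮a))
          code : A → ℕ × (ℕ × B)
          code a = proj₁ (above a) , to (closedSegment (s (proj₁ (above a)))) (a , [ proj₂ (above a) ])
      in A↣̸B (ℕ×ℕ×B↣B ∘↣ mk↣ {to = code} λ {a} {a′} → separate (above a) (above a′))
      where
      separate : ∀ {a a′} (p : ∃[ n ] ¬ (s n < a)) (p′ : ∃[ n ] ¬ (s n < a′)) →
        (proj₁ p , to (closedSegment (s (proj₁ p))) (a , [ proj₂ p ])) ≡
        (proj₁ p′ , to (closedSegment (s (proj₁ p′))) (a′ , [ proj₂ p′ ])) → a ≡ a′
      separate {a} {a′} (n , q) (n′ , q′) eq with refl ← cong proj₁ eq =
        closedSegment-value (s n) (a , [ q ]) (a′ , [ q′ ]) (cong proj₂ eq)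

  aleph-infiniteCardinal : ∀ n {A : Set ℓ} → HasCardinality-ℵ n A → InfiniteCardinal A
  aleph-infiniteCardinal zero (lift A↔ℕ) = ℕ-infiniteCardinal A↔ℕ
  aleph-infiniteCardinal (ℕ.suc n) (B , ℵB , A↣̸B , _ , wo , segment) =
    Successor.infiniteCardinal (aleph-infiniteCardinal n ℵB) A↣̸B wo segment

  -- The Schröder-Bernstein theorem

  module _ {A B : Set ℓ} (f : A ↣ B) (g : B ↣ A) where
    private
      -- Tracing preimages alternately through `g` and `f`, these are the points whose ancestry ends
      -- in `A` after finitely many steps. They are matched along `f`, all others along the inverse
      -- of `g`.
      data Orphan : Pred A ℓ where
        root : ∀ {a} → (∀ b → to g b ≢ a) → Orphan a
        next : ∀ {a} → Orphan a → Orphan (to g (to f a))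

      parent : ∀ {a b} → Orphan a → a ≡ to g b → ∃[ a′ ] (Orphan a′ × to f a′ ≡ b)
      parent {b = b} (root ∉g) eq = contradiction (sym eq) (∉g b)
      parent (next {a} o) eq = a , o , injective g eq

      match : ∀ a → ∃[ b ] ((Orphan a × to f a ≡ b) ⊎ (¬ Orphan a × to g b ≡ a))
      match a with em {P = Orphan a}
      ... | yes o = to f a , inj₁ (o , refl)
      ... | no ¬o = let (b , eq) = stable λ ∉g → ¬o (root λ b eq → ∉g (b , eq)) in b , inj₂ (¬o , eq)

      match-injective : ∀ {a a′} → proj₁ (match a) ≡ proj₁ (match a′) → a ≡ a′
      match-injective {a} {a′} eq with match a | match a′ | eq
      ... | _ , inj₁ (_ , e) | _ , inj₁ (_ , e′) | refl = injective f (trans e (sym e′))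
      ... | _ , inj₂ (_ , e) | _ , inj₂ (_ , e′) | refl = trans (sym e) e′
      ... | _ , inj₁ (o , refl) | _ , inj₂ (¬o , e′) | refl = contradiction (subst Orphan e′ (next o)) ¬o
      ... | _ , inj₂ (¬o , e) | _ , inj₁ (o , refl) | refl = contradiction (subst Orphan e (next o)) ¬o

      match-surjective : ∀ b → ∃[ a ] proj₁ (match a) ≡ b
      match-surjective b with em {P = Orphan (to g b)}
      ... | no ¬o = to g b , unmatched
        where
        unmatched : proj₁ (match (to g b)) ≡ b
        unmatched with match (to g b)
        ... | _ , inj₁ (o , _) = contradiction o ¬o
        ... | _ , inj₂ (_ , e) = injective g e
      ... | yes o = let (a , o′ , e) = parent o refl in a , trans (matched o′) e
        where
        matched : ∀ {a} → Orphan a → proj₁ (match a) ≡ to f a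
        matched {a} o with match a
        ... | _ , inj₁ (_ , e) = sym e
        ... | _ , inj₂ (¬o , _) = contradiction o ¬o

    schröder-bernstein : A ↔ B
    schröder-bernstein = ⤖⇒↔ (mk⤖ (match-injective , λ b → proj₁ (match-surjective b) , λ { refl → proj₂ (match-surjective b) }))

-- Metrics

-- mkℚ stores the predecessor of the denominator, so this is 1/(n+1).
radius : ℕ → ℚ
radius n = mkℚ (ℤ.+ 1) n (1-coprimeTo (ℕ.suc n))

0<radius : ∀ n → 0ℚ < radius n
0<radius n = ℚₚ.positive⁻¹ (radius n)

radius-antitone : ∀ {m n} → m ℕ.≤ n → radius n ≤ radius m
radius-antitone m≤n = *≤* (ℤ.+≤+ (ℕₚ.*-monoʳ-≤ 1 (ℕ.s≤s m≤n)))

radius≤1 : ∀ n → radius n ≤ 1ℚ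
radius≤1 n = radius-antitone {0} ℕ.z≤n

-- A positive fraction has numerator at least 1, so its own denominator works.
archimedean : ∀ {ε} → 0ℚ < ε → ∃[ n ] radius n ≤ ε
archimedean {mkℚ (ℤ.+ 0) n _} (*<* (ℤ.+<+ ()))
archimedean {mkℚ (ℤ.+ ℕ.suc m) n _} _ =
  n , *≤* (ℤ.+≤+ (ℕₚ.*-monoˡ-≤ (ℕ.suc n) {1} {ℕ.suc m} (ℕ.s≤s ℕ.z≤n)))
archimedean {mkℚ (ℤ.-[1+ _ ]) n _} (*<* ())

half : ℚ → ℚ
half ε = ½ * ε

half-sum : ∀ ε → half ε + half ε ≡ ε
half-sum ε = trans (sym (ℚₚ.*-distribʳ-+ ε ½ ½)) (ℚₚ.*-identityˡ ε)

0<half : ∀ {ε} → 0ℚ < ε → 0ℚ < half ε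
0<half {ε} 0<ε = subst (_< half ε) (ℚₚ.*-zeroʳ ½) (ℚₚ.*-monoʳ-<-pos ½ 0<ε)

<-+ʳ : ∀ {p q} → 0ℚ < q → p < p + q
<-+ʳ {p} {q} 0<q = subst (_< p + q) (ℚₚ.+-identityʳ p) (ℚₚ.+-monoʳ-< p 0<q)

half< : ∀ {ε} → 0ℚ < ε → half ε < ε
half< {ε} 0<ε = subst (half ε <_) (half-sum ε) (<-+ʳ (0<half 0<ε))

0<* : ∀ {p q} → 0ℚ < p → 0ℚ < q → 0ℚ < p * q
0<* {p} {q} 0<p 0<q =
  subst (_< p * q) (ℚₚ.*-zeroʳ p) (ℚₚ.*-monoʳ-<-pos p {{ℚ.positive 0<p}} 0<q)

0<⊓ : ∀ {p q} → 0ℚ < p → 0ℚ < q → 0ℚ < p ⊓ q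
0<⊓ {p} {q} 0<p 0<q with ℚₚ.⊓-sel p q
... | inj₁ eq = subst (0ℚ <_) (sym eq) 0<p
... | inj₂ eq = subst (0ℚ <_) (sym eq) 0<q

reciprocal : ∀ {p} → 0ℚ < p → ∃[ q ] (0ℚ < q × p * q ≡ 1ℚ)
reciprocal {p} 0<p =
  (ℚ.1/ p) , ℚₚ.positive⁻¹ _ {{ℚₚ.1/pos⇒pos p}} , ℚₚ.*-inverseʳ p
  where
  instance
    p-positive : ℚ.Positive p
    p-positive = ℚ.positive 0<p
    p-nonZero : ℚ.NonZero p
    p-nonZero = ℚₚ.pos⇒nonZero p

p<q⇒0<q-p : ∀ {p q} → p < q → 0ℚ < q - p
p<q⇒0<q-p {p} {q} p<q = subst (_< q - p) (ℚₚ.+-inverseʳ p) (ℚₚ.+-monoˡ-< (ℚ.- p) p<q)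

p+[q-p]≡q : ∀ p q → p + (q - p) ≡ q
p+[q-p]≡q = +-*-Solver.solve 2 (λ p q → p :+ (q :- p) := q) refl
  where open +-*-Solver

-- t ≤ 1/q implies t − ε ≤ 1/(q + δ), cleared of denominators.
shifted-bound : ∀ {t q δ η ε} → 0ℚ < η → 0ℚ < ε → 0ℚ < δ → η ≤ q → δ ≤ ε * (η * η) →
                t * q ≤ 1ℚ → (t - ε) * (q + δ) ≤ 1ℚ
shifted-bound {t} {q} {δ} {η} {ε} 0<η 0<ε 0<δ η≤q δ≤εηη tq≤1 = begin
  (t - ε) * (q + δ)              ≡⟨ expand t q δ ε ⟩
  t * q + (t * δ - ε * (q + δ))  ≤⟨ ℚₚ.+-mono-≤ tq≤1 (ℚₚ.+-monoˡ-≤ (ℚ.- (ε * (q + δ))) tδ≤ε[q+δ]) ⟩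
  1ℚ + (ε * (q + δ) - ε * (q + δ)) ≡⟨ cong (1ℚ +_) (ℚₚ.+-inverseʳ (ε * (q + δ))) ⟩
  1ℚ + 0ℚ                        ≡⟨ ℚₚ.+-identityʳ 1ℚ ⟩
  1ℚ                             ∎
  where
  open ℚₚ.≤-Reasoning
  0<q : 0ℚ < q
  0<q = ℚₚ.<-≤-trans 0<η η≤q
  instance
    q-positive : ℚ.Positive q
    q-positive = ℚ.positive 0<q
    q-nonNegative : ℚ.NonNegative q
    q-nonNegative = ℚₚ.pos⇒nonNeg q
    η-nonNegative : ℚ.NonNegative η
    η-nonNegative = ℚₚ.pos⇒nonNeg η {{ℚ.positive 0<η}}
    ε-nonNegative : ℚ.NonNegative ε
    ε-nonNegative = ℚₚ.pos⇒nonNeg ε {{ℚ.positive 0<ε}}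
    δ-nonNegative : ℚ.NonNegative δ
    δ-nonNegative = ℚₚ.pos⇒nonNeg δ {{ℚ.positive 0<δ}}
  expand : ∀ t q δ ε → (t - ε) * (q + δ) ≡ t * q + (t * δ - ε * (q + δ))
  expand = solve 4 (λ t q δ ε → (t :- ε) :* (q :+ δ) := t :* q :+ (t :* δ :- ε :* (q :+ δ))) refl
    where open +-*-Solver
  rearrange : ∀ q t δ → q * (t * δ) ≡ (t * q) * δ
  rearrange = solve 3 (λ q t δ → q :* (t :* δ) := (t :* q) :* δ) refl
    where open +-*-Solver
  swap : ∀ ε q → ε * (q * q) ≡ q * (ε * q)
  swap = solve 2 (λ ε q → ε :* (q :* q) := q :* (ε :* q)) refl
    where open +-*-Solver
  -- Multiplying by `q` turns the left side into `(t * q) * δ`, to which `tq≤1` applies.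
  q*tδ≤q*εq : q * (t * δ) ≤ q * (ε * q)
  q*tδ≤q*εq = begin
    q * (t * δ)  ≡⟨ rearrange q t δ ⟩
    (t * q) * δ  ≤⟨ ℚₚ.*-monoʳ-≤-nonNeg δ tq≤1 ⟩
    1ℚ * δ       ≡⟨ ℚₚ.*-identityˡ δ ⟩
    δ            ≤⟨ δ≤εηη ⟩
    ε * (η * η)  ≤⟨ ℚₚ.*-monoˡ-≤-nonNeg ε (ℚₚ.*-monoˡ-≤-nonNeg η η≤q) ⟩
    ε * (η * q)  ≤⟨ ℚₚ.*-monoˡ-≤-nonNeg ε (ℚₚ.*-monoʳ-≤-nonNeg q η≤q) ⟩
    ε * (q * q)  ≡⟨ swap ε q ⟩
    q * (ε * q)  ∎
  tδ≤ε[q+δ] : t * δ ≤ ε * (q + δ)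
  tδ≤ε[q+δ] = ℚₚ.≤-trans (ℚₚ.*-cancelˡ-≤-pos q q*tδ≤q*εq)
    (ℚₚ.*-monoˡ-≤-nonNeg ε (ℚₚ.<⇒≤ (<-+ʳ 0<δ)))

module MetricProperties {ℓ} {X : Set ℓ} (M : Metric X) where

  open Metric M
  private module D = IsGeneralMetric isMetric

  dist-positive : ∀ {x y q} → d x y <ℚ q → 0ℚ < q
  dist-positive = D.nonNegative

  dist-refl : ∀ {x q} → 0ℚ < q → d x x <ℚ q
  dist-refl = proj₂ (D.≈⇒0 refl)

  dist-sym : ∀ {x y q} → d x y <ℚ q → d y x <ℚ q
  dist-sym {x} {y} = proj₁ (D.sym x y)

  dist-triangle : ∀ {x y z p q} → d x y <ℚ p → d y z <ℚ q → d x z <ℚ p + q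
  dist-triangle {x} {y} {z} x~y y~z = D.triangle x y z (_ , _ , x~y , y~z , refl)

  dist-mono : ∀ {x y p q} → p ≤ q → d x y <ℚ p → d x y <ℚ q
  dist-mono {x} {y} p≤q x~y =
    let (r , r<p , x~y′) = rounded (d x y) x~y in upward (d x y) (ℚₚ.<-≤-trans r<p p≤q) x~y′

  dist-separated : ∀ {x y} → (∀ q → 0ℚ < q → d x y <ℚ q) → x ≡ y
  dist-separated x~y = D.0⇒≈ (dist-positive , x~y _)

  dist-halves : ∀ {x y z ε} → d x y <ℚ half ε → d y z <ℚ half ε → d x z <ℚ ε
  dist-halves {x} {z = z} {ε} x~y y~z = subst (d x z <ℚ_) (half-sum ε) (dist-triangle x~y y~z)

  Closed : Pred (Pred X ℓ) ℓ
  Closed C = ∀ x → (∀ ε → 0ℚ < ε → ∃[ c ] (c ∈ C × d x c <ℚ ε)) → x ∈ C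

  -- Expresses `d(x,C) ≥ η` in terms of upper cuts; it holds for every `η` when `C` is empty.
  Far : ℚ → X → Pred X ℓ → Set ℓ
  Far η x C = ∀ {c q} → c ∈ C → d x c <ℚ q → η < q

  closure : {K : Set ℓ} → (K → X) → Pred X ℓ
  closure y x = ∀ ε → 0ℚ < ε → ∃[ k ] d x (y k) <ℚ ε

  closure-closed : {K : Set ℓ} (y : K → X) → Closed (closure y)
  closure-closed y x near ε 0<ε =
    let (c , c∈ , x~c) = near (half ε) (0<half 0<ε)
        (k , c~y) = c∈ (half ε) (0<half 0<ε)
    in k , dist-halves x~c c~y

  ball-open : ∀ x ε → MetricOpen M (λ y → Lift ℓ (d x y <ℚ ε))
  ball-open x ε y (lift x~y) =
    let (r , r<ε , x~y′) = rounded (d x y) x~y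
    in ε - r , p<q⇒0<q-p r<ε , λ z y~z → lift (subst (d x z <ℚ_) (p+[q-p]≡q r ε) (dist-triangle x~y′ y~z))

-- Metrics from nearness relations

record Gauge {ℓ} (Y : Set ℓ) : Set (suc ℓ) where
  field
    Near      : ℚ → Rel Y ℓ
    positive  : ∀ {r x y} → Near r x y → 0ℚ < r
    monotone  : ∀ {r s x y} → r ≤ s → Near r x y → Near s x y
    reflexive : ∀ {r x} → 0ℚ < r → Near r x x
    symmetric : ∀ {r x y} → Near r x y → Near r y x
    triangle  : ∀ {r s x y z} → Near r x y → Near s y z → Near (r + s) x z
    finite    : ∀ x y → ∃[ r ] Near r x y
    separated : ∀ {x y} → (∀ r → 0ℚ < r → Near r x y) → x ≡ y

module GaugeMetric {ℓ} (em : ExcludedMiddle ℓ) {Y : Set ℓ} (G : Gauge Y) where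

  open Gauge G

  -- Cuts are predicates at level 0ℓ, so Near is resized through its truth value.
  metric : Metric Y
  metric = record
    { d = dist
    ; isMetric = record
      { isSemiMetric = record
        { isQuasiSemiMetric = record
          { isPreMetric = record
            { isProtoMetric = record
              { isPartialOrder = record
                { isPreorder = record
                  { isEquivalence = record
                    { refl = id , id
                    ; sym = λ (p , q) → q , p
                    ; trans = λ (p , q) (p′ , q′) → p′ ∘ p , q ∘ q′ }
                  ; reflexive = proj₂
                  ; trans = λ p q → p ∘ q
                  }
                ; antisym = λ p q → q , p
                }
              ; ≈-isEquivalence = isEquivalence
              ; cong = λ { refl refl → id , id }
              ; nonNegative = λ {x} {y} p → positive (within⇒near x y p)
              }
            ; ≈⇒0 = λ { {x} refl → (λ p → positive (within⇒near x x p)) , near⇒within x x ∘ reflexive′ }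
            }
          ; 0⇒≈ = λ {x} {y} (_ , p) → separated λ r 0<r → within⇒near x y (p 0<r)
          }
        ; sym = λ x y → flip′ x y , flip′ y x
        }
      ; triangle = λ { x y z (a , b , p , q , refl) → tri x y z p q }
      }
    }
    where
    -- The distance is the infimum of the `r` with `Near r x y`; the strict `r < q` makes the cut
    -- rounded.
    Within : Y → Y → ℚ → Set
    Within x y q = True (em {P = ∃[ r ] (r < q × Near r x y)})
    within⇒near : ∀ x y {q} → Within x y q → Near q x y
    within⇒near x y w = let (r , r<q , n) = toWitness w in monotone (ℚₚ.<⇒≤ r<q) n
    near⇒within : ∀ x y {q} → ∃[ r ] (r < q × Near r x y) → Within x y q
    near⇒within x y = fromWitness
    reflexive′ : ∀ {x q} → 0ℚ < q → ∃[ r ] (r < q × Near r x x)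
    reflexive′ {q = q} 0<q = half q , half< 0<q , reflexive (0<half 0<q)
    flip′ : ∀ x y {q} → Within x y q → Within y x q
    flip′ x y w = let (r , r<q , n) = toWitness w in near⇒within y x (r , r<q , symmetric n)
    tri : ∀ x y z {p q} → Within x y p → Within y z q → Within x z (p + q)
    tri x y z v w =
      let (r , r<p , m) = toWitness v ; (s , s<q , n) = toWitness w
      in near⇒within x z (r + s , ℚₚ.+-mono-< r<p s<q , triangle m n)
    dist : Y → Y → ℝ
    dist x y = record
      { cut = Within x y
      ; inhabited = let (r , n) = finite x y
                    in r + 1ℚ , near⇒within x y (r , <-+ʳ (ℚₚ.positive⁻¹ 1ℚ) , n)
      ; proper = 0ℚ , λ w → ℚₚ.<-irrefl refl (positive (within⇒near x y w))
      ; upward = λ p<q w → let (r , r<p , n) = toWitness w in near⇒within x y (r , ℚₚ.<-trans r<p p<q , n)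
      ; rounded = λ w → let (r , r<q , n) = toWitness w ; (p , r<p , p<q) = ℚₚ.<-dense r<q
                        in p , p<q , near⇒within x y (r , r<p , n)
      }

  open Metric metric

  dist⇒near : ∀ x y {q} → d x y <ℚ q → Near q x y
  dist⇒near x y w = let (r , r<q , n) = toWitness w in monotone (ℚₚ.<⇒≤ r<q) n

  near⇒dist : ∀ x y {r q} → r < q → Near r x y → d x y <ℚ q
  near⇒dist x y r<q n = fromWitness (_ , r<q , n)

-- A set C ∖ ⋃ₖ Cₖ, with C and all Cₖ closed, is completely metrized by
-- max (d x y, supₖ min (1/(k+1), ∣1/d(x,Cₖ) − 1/d(y,Cₖ)∣)).
module ClosedMinusFσ {ℓ} (em : ExcludedMiddle ℓ) {X : Set ℓ} (M : Metric X)
  (C : Pred X ℓ) (Cs : ℕ → Pred X ℓ) where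

  open Classical em
  open Metric M
  open MetricProperties M

  Points : Pred X ℓ
  Points x = x ∈ C × (∀ k → x ∉ Cs k)

  -- Expresses t < 1/d(x,S) for t > 0; false when S is empty.
  record BelowInverse (S : Pred X ℓ) (t : ℚ) (x : X) : Set ℓ where
    constructor below
    field
      {point} : X
      point∈S : point ∈ S
      {bound} : ℚ
      x~point : d x point <ℚ bound
      t*bound : t * bound ≤ 1ℚ

  -- 1/d(x,S) ≤ 1/d(y,S) + r
  record Shift (S : Pred X ℓ) (r : ℚ) (x y : X) : Set ℓ where
    constructor shift
    field
      apply : ∀ t → BelowInverse S t x → BelowInverse S (t - r) y

  open Shift

  belowInverse-mono : ∀ {S s t x} → s ≤ t → BelowInverse S t x → BelowInverse S s x
  belowInverse-mono s≤t (below c∈S {q} x~c tq≤1) =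
    below c∈S x~c (ℚₚ.≤-trans (ℚₚ.*-monoʳ-≤-nonNeg q s≤t) tq≤1)
    where
    instance
      q-nonNegative : ℚ.NonNegative q
      q-nonNegative = ℚₚ.pos⇒nonNeg q {{ℚ.positive (dist-positive x~c)}}

  shift-refl : ∀ {S r x} → 0ℚ ≤ r → Shift S r x x
  shift-refl {r = r} 0≤r = shift λ t → belowInverse-mono
    (subst (t - r ≤_) (ℚₚ.+-identityʳ t) (ℚₚ.+-monoʳ-≤ t (ℚₚ.neg-antimono-≤ 0≤r)))

  shift-mono : ∀ {S r s x y} → r ≤ s → Shift S r x y → Shift S s x y
  shift-mono r≤s f = shift λ t b → belowInverse-mono (ℚₚ.+-monoʳ-≤ t (ℚₚ.neg-antimono-≤ r≤s)) (apply f t b)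

  shift-trans : ∀ {S r s x y z} → Shift S r x y → Shift S s y z → Shift S (r + s) x z
  shift-trans {S} {r} {s} {z = z} f g = shift λ t b →
    subst (λ u → BelowInverse S u z) (assoc t r s) (apply g (t - r) (apply f t b))
    where
    assoc : ∀ t r s → (t - r) - s ≡ t - (r + s)
    assoc = solve 3 (λ t r s → (t :- r) :- s := t :- (r :+ s)) refl
      where open +-*-Solver

  -- Away from `S` the function `1/d(·,S)` is continuous: the witness for `x` also serves for `y`
  -- once its bound is enlarged by `δ`, and `shifted-bound` gives the cost.
  shift-near : ∀ {S ε δ η x y} → 0ℚ < η → 0ℚ < ε → Far η x S → δ ≤ ε * (η * η) →
               d x y <ℚ δ → Shift S ε x y
  shift-near {δ = δ} 0<η 0<ε far δ≤ x~y = shift λ { t (below {c} c∈S {q} x~c tq≤1) →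
    below c∈S (subst (d _ c <ℚ_) (ℚₚ.+-comm δ q) (dist-triangle (dist-sym x~y) x~c))
      (shifted-bound {t} 0<η 0<ε (dist-positive x~y) (ℚₚ.<⇒≤ (far c∈S x~c)) δ≤ tq≤1) }

  closed⇒far : ∀ {S x} → Closed S → x ∉ S → ∃[ η ] (0ℚ < η × Far η x S)
  closed⇒far {S} {x} closed x∉S = stable λ ¬far → x∉S (closed x λ ε 0<ε → stable λ ¬near →
    ¬far (ε , 0<ε , λ {c} {q} c∈S x~c → ℚₚ.≰⇒> λ q≤ε → ¬near (c , c∈S , dist-mono q≤ε x~c)))

  far-near : ∀ {S η x y} → Far η x S → d x y <ℚ half η → Far (half η) y S
  far-near {η = η} far x~y {q = q} c∈S y~c = ℚₚ.≰⇒> λ q≤ →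
    ℚₚ.<-irrefl refl (subst (η <_) (half-sum η) (far c∈S (dist-triangle x~y (dist-mono q≤ y~c))))

  -- Expresses `min (1/(k+1), ∣1/d(x,Cₖ) − 1/d(y,Cₖ)∣) ≤ r`, with one shift for each sign of the
  -- difference.
  Close : ℕ → ℚ → Rel X ℓ
  Close k r x y = Lift ℓ (radius k ≤ r) ⊎ (Shift (Cs k) r x y × Shift (Cs k) r y x)

  close-mono : ∀ {k r s x y} → r ≤ s → Close k r x y → Close k s x y
  close-mono r≤s (inj₁ (lift k≤r)) = inj₁ (lift (ℚₚ.≤-trans k≤r r≤s))
  close-mono r≤s (inj₂ (f , g)) = inj₂ (shift-mono r≤s f , shift-mono r≤s g)

  close-triangle : ∀ {k r s x y z} → 0ℚ < r → 0ℚ < s → Close k r x y → Close k s y z → Close k (r + s) x z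
  close-triangle {r = r} {s} 0<r 0<s (inj₁ (lift k≤r)) _ = inj₁ (lift (ℚₚ.≤-trans k≤r (ℚₚ.<⇒≤ (<-+ʳ 0<s))))
  close-triangle {r = r} {s} 0<r 0<s (inj₂ _) (inj₁ (lift k≤s)) =
    inj₁ (lift (ℚₚ.≤-trans k≤s (subst (s ≤_) (ℚₚ.+-comm s r) (ℚₚ.<⇒≤ (<-+ʳ 0<r)))))
  close-triangle {k} {r} {s} {x} {z = z} _ _ (inj₂ (f , f′)) (inj₂ (g , g′)) = inj₂
    (shift-trans f g , subst (λ u → Shift (Cs k) u z x) (ℚₚ.+-comm s r) (shift-trans g′ f′))

  Near : ℚ → Rel X ℓ
  Near r x y = Lift ℓ (d x y <ℚ r) × (∀ k → Close k r x y)

  gauge : Gauge (Refinement X Points)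
  gauge = record
    { Near      = λ r x y → Near r (value x) (value y)
    ; positive  = λ (lift x~y , _) → dist-positive x~y
    ; monotone  = λ r≤s (lift x~y , close) → lift (dist-mono r≤s x~y) , λ k → close-mono r≤s (close k)
    ; reflexive = λ 0<r → lift (dist-refl 0<r) , λ k → inj₂ (shift-refl (ℚₚ.<⇒≤ 0<r) , shift-refl (ℚₚ.<⇒≤ 0<r))
    ; symmetric = λ (lift x~y , close) → lift (dist-sym x~y) , λ k → [ inj₁ , (λ (f , g) → inj₂ (g , f)) ]′ (close k)
    ; triangle  = λ (lift x~y , close) (lift y~z , close′) → lift (dist-triangle x~y y~z) ,
                  λ k → close-triangle (dist-positive x~y) (dist-positive y~z) (close k) (close′ k)
    ; finite    = λ x y →
                  let (q , x~y) = inhabited (d (value x) (value y))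
                  in q + 1ℚ , lift (upward (d (value x) (value y)) (<-+ʳ (ℚₚ.positive⁻¹ 1ℚ)) x~y) ,
                     λ k → inj₁ (lift (ℚₚ.≤-trans (radius≤1 k)
                       (subst (1ℚ ≤_) (ℚₚ.+-comm 1ℚ q) (ℚₚ.<⇒≤ (<-+ʳ (dist-positive x~y))))))
    ; separated = λ near → value-injective (dist-separated λ q 0<q → lower (proj₁ (near q 0<q)))
    }

  module G = GaugeMetric em gauge

  module _ (C-closed : Closed C) (Cs-closed : ∀ k → Closed (Cs k)) where

    close-nhd : ∀ {x ε} → x ∈ Points → 0ℚ < ε → ∀ k → ∃[ δ ] (0ℚ < δ × (∀ y → d x y <ℚ δ → Close k ε x y))
    close-nhd {x} {ε} (_ , x∉Cs) 0<ε k =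
      let (η , 0<η , far) = closed⇒far (Cs-closed k) (x∉Cs k)
          0<h = 0<half 0<η
          -- Points within `h` of `x` are still at distance at least `h` from `Cs k`, so one `δ`
          -- serves both shifts.
          h = half η
          δ≤ = ℚₚ.p⊓q≤q h (ε * (h * h))
      in (h ⊓ (ε * (h * h))) , 0<⊓ 0<h (0<* 0<ε (0<* 0<h 0<h)) , λ y x~y →
         let x~y′ = dist-mono (ℚₚ.p⊓q≤p h (ε * (h * h))) x~y
         in inj₂ ( shift-near 0<h 0<ε (λ c∈ x~c → ℚₚ.<-trans (half< 0<η) (far c∈ x~c)) δ≤ x~y
                 , shift-near 0<h 0<ε (far-near far x~y′) δ≤ (dist-sym x~y) )

    close-nhds : ∀ {x ε} → x ∈ Points → 0ℚ < ε → ∀ n →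
      ∃[ δ ] (0ℚ < δ × (∀ y → d x y <ℚ δ → ∀ {k} → k ℕ.< n → Close k ε x y))
    close-nhds x∈ 0<ε zero = 1ℚ , ℚₚ.positive⁻¹ 1ℚ , λ _ _ ()
    close-nhds {x} {ε} x∈ 0<ε (ℕ.suc n) =
      let (δ , 0<δ , f) = close-nhds x∈ 0<ε n
          (δ′ , 0<δ′ , g) = close-nhd x∈ 0<ε n
      in δ ⊓ δ′ , 0<⊓ 0<δ 0<δ′ , λ y x~y k<1+n →
         [ f y (dist-mono (ℚₚ.p⊓q≤p δ δ′) x~y)
         , (λ { refl → g y (dist-mono (ℚₚ.p⊓q≤q δ δ′) x~y) }) ]′ (ℕₚ.m≤n⇒m<n∨m≡n (ℕ.s≤s⁻¹ k<1+n))

    -- The truncation leaves finitely many `k` to control: from `n` on, `radius k ≤ ε`.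
    near-nhd : ∀ {x ε} → x ∈ Points → 0ℚ < ε → ∃[ δ ] (0ℚ < δ × (∀ y → d x y <ℚ δ → Near ε x y))
    near-nhd {x} {ε} x∈ 0<ε =
      let (n , n≤ε) = archimedean 0<ε
          (δ , 0<δ , f) = close-nhds x∈ 0<ε n
      in δ ⊓ ε , 0<⊓ 0<δ 0<ε , λ y x~y → lift (dist-mono (ℚₚ.p⊓q≤q δ ε) x~y) , λ k →
         case ℕₚ.<-≤-connex k n of λ where
           (inj₁ k<n) → f y (dist-mono (ℚₚ.p⊓q≤p δ ε) x~y) k<n
           (inj₂ n≤k) → inj₁ (lift (ℚₚ.≤-trans (radius-antitone n≤k) n≤ε))

    dist-nhd : ∀ x {ε} → 0ℚ < ε →
      ∃[ δ ] (0ℚ < δ × (∀ y → d (value x) (value y) <ℚ δ → Metric.d G.metric x y <ℚ ε))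
    dist-nhd x 0<ε =
      let (δ , 0<δ , f) = near-nhd (relevant {P = Points} x) (0<half 0<ε)
      in δ , 0<δ , λ y x~y → G.near⇒dist x y (half< 0<ε) (f (value y) x~y)

    -- A Cauchy sequence for the new metric is Cauchy for `d`. Once its `d`-limit is known to lie in
    -- `Points`, `dist-nhd` turns `d`-convergence into convergence for the new metric.
    complete : IsComplete M → IsComplete G.metric
    complete M-complete s cauchy = (x , [ x∈Points ]) , λ ε 0<ε →
      let (δ , 0<δ , f) = dist-nhd (x , [ x∈Points ]) 0<ε
          (n , g) = s→x δ 0<δ
      in n , λ m n≤m → MetricProperties.dist-sym G.metric {x , [ x∈Points ]} {s m} (f (s m) (dist-sym (g m n≤m)))
      where
      limit : ∃[ x ] ConvergesTo M (value ∘ s) x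
      limit = M-complete (value ∘ s) λ ε 0<ε →
        let (n , f) = cauchy ε 0<ε in n , λ m m′ p q → lower (proj₁ (G.dist⇒near (s m) (s m′) (f m m′ p q)))
      x : X
      x = proj₁ limit
      s→x : ConvergesTo M (value ∘ s) x
      s→x = proj₂ limit
      s∈ : ∀ n → value (s n) ∈ Points
      s∈ n = relevant {P = Points} (s n)

      -- Otherwise 1/d(sₙ,Cₖ) would be unbounded although the tail of s is Cauchy.
      x∉Cs : ∀ k → x ∉ Cs k
      x∉Cs k x∈Cs =
        -- At tolerance `radius k` the truncation alternative is impossible, so closeness gives a
        -- shift.
        let (n , tail) = cauchy (radius k) (0<radius k)
            (η , 0<η , far) = closed⇒far (Cs-closed k) (proj₂ (s∈ n) k)
            (1/η , 0<1/η , η*1/η≡1) = reciprocal 0<η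
            -- A term within `1/t` of `x` has inverse distance to `Cs k` above `t`. Shifting by
            -- `radius k` would put that of `s n` above `1/η`, against `far`.
            t = 1/η + radius k
            0<t = ℚₚ.<-trans 0<1/η (<-+ʳ (0<radius k))
            (1/t , 0<1/t , t*1/t≡1) = reciprocal 0<t
            (n′ , near) = s→x 1/t 0<1/t
            m = n ℕ.⊔ n′
            (r , r<k , n~m) = toWitness (tail m n (ℕₚ.m≤m⊔n n n′) ℕₚ.≤-refl)
        in case proj₂ n~m k of λ where
          (inj₁ (lift k≤r)) → ℚₚ.<-irrefl refl (ℚₚ.≤-<-trans k≤r r<k)
          (inj₂ (m→n , _)) →
            let (below c∈ {q} n~c tq≤1) = apply (shift-mono (ℚₚ.<⇒≤ r<k) m→n) t
                  (below x∈Cs (near m (ℕₚ.m≤n⊔m n n′)) (ℚₚ.≤-reflexive t*1/t≡1))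
                1/η<1/η = subst₂ _<_ (trans (ℚₚ.*-comm 1/η η) η*1/η≡1) (cong (_* q) (sym (cancel 1/η (radius k))))
                  (ℚₚ.*-monoʳ-<-pos 1/η {{ℚ.positive 0<1/η}} (far c∈ n~c))
            in ℚₚ.<-irrefl refl (ℚₚ.<-≤-trans 1/η<1/η tq≤1)
        where
        cancel : ∀ p r → (p + r) - r ≡ p
        cancel = solve 2 (λ p r → (p :+ r) :- r := p) refl
          where open +-*-Solver

      x∈Points : x ∈ Points
      x∈Points = C-closed x (λ ε 0<ε → let (n , f) = s→x ε 0<ε
                                       in value (s n) , proj₁ (s∈ n) , dist-sym (f n ℕₚ.≤-refl)) ,
                 x∉Cs

    completelyMetrizable : (T : Topology X) → IsComplete M → (∀ U → Open T U ⇔ MetricOpen M U) →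
                           CompletelyMetrizable (subspace T Points)
    completelyMetrizable T M-complete open⇔ = G.metric , complete M-complete , λ V → mk⇔ (open⇒ V) (⇒open V)
      where
      open⇒ : ∀ V → Open (subspace T Points) V → MetricOpen G.metric V
      open⇒ V (U , U-open , V⊆U , U⊆V) x x∈V =
        let (ε , 0<ε , ball⊆U) = Equivalence.to (open⇔ U) U-open (value x) (V⊆U x∈V)
        in ε , 0<ε , λ y x~y → U⊆V (ball⊆U (value y) (lower (proj₁ (G.dist⇒near x y x~y))))
      ⇒open : ∀ V → MetricOpen G.metric V → Open (subspace T Points) V
      ⇒open V V-open = U , Equivalence.from (open⇔ U) U-open , V⊆U , U⊆V
        where
        -- The largest open set of `X` whose trace on `Points` is `V`.
        U : Pred X ℓ
        U x = ∃[ ε ] (0ℚ < ε × (∀ y → d x (value y) <ℚ ε → y ∈ V))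
        U-open : MetricOpen M U
        U-open x (ε , 0<ε , f) = half ε , 0<half 0<ε , λ y x~y → half ε , 0<half 0<ε , λ z y~z → f z (dist-halves x~y y~z)
        V⊆U : ∀ {x} → x ∈ V → U (value x)
        V⊆U {x} x∈V =
          let (ε , 0<ε , ball⊆V) = V-open x x∈V
              (δ , 0<δ , f) = dist-nhd x 0<ε
          in δ , 0<δ , λ y x~y → ball⊆V y (f y x~y)
        U⊆V : ∀ {x} → U (value x) → x ∈ V
        U⊆V {x} (ε , 0<ε , f) = f x (dist-refl 0<ε)

    -- The `y k` may lie outside `Points`, so every ball `radius n` around `y k` that meets `Points`
    -- contributes one point of it.
    separable : (T : Topology X) → (∀ U → Open T U ⇔ MetricOpen M U) →
      {K : Set ℓ} → K ↣ ℕ → (y : K → X) → Points ⊆ closure y → Separable (subspace T Points)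
    separable T open⇔ {K} K↣ℕ y dense = D , D-dense , D-countable
      where
      Y : Set ℓ
      Y = Refinement X Points

      Chosen : K → ℕ → Set ℓ
      Chosen k n = ∃[ z ] d (value {P = Points} z) (y k) <ℚ radius n

      -- The answer of `em` acts as a choice function: it returns at most one `z` for each
      -- `(k , n)`, which makes `(k , n)` a code for `z`.
      D : Pred Y ℓ
      D z = ∃[ k ] ∃[ n ] ∃[ c ] (em {P = Chosen k n} ≡ yes c × proj₁ c ≡ z)

      D-dense : IsDense (subspace T Points) D
      D-dense V (U , U-open , V⊆U , U⊆V) (x , x∈V) =
        let (ε , 0<ε , ball⊆U) = Equivalence.to (open⇔ U) U-open (value x) (V⊆U x∈V)
            (n , n≤) = archimedean (0<half 0<ε)
            (k , x~yk) = dense (relevant {P = Points} x) (radius n) (0<radius n)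
        in pick k n (x , x~yk) λ z z~yk →
             U⊆V (ball⊆U (value z) (dist-halves (dist-mono n≤ x~yk) (dist-mono n≤ (dist-sym z~yk))))
        where
        pick : ∀ k n → Chosen k n → (∀ z → d (value z) (y k) <ℚ radius n → z ∈ V) → ∃[ z ] (z ∈ D × z ∈ V)
        pick k n chosen near with em {P = Chosen k n} in eq
        ... | yes c = proj₁ c , (k , n , c , eq , refl) , near (proj₁ c) (proj₂ c)
        ... | no none = contradiction chosen none

      D-countable : Refinement Y D ↣ ℕ
      D-countable = ℕ×ℕ↣ℕ ∘↣ (K↣ℕ ×-↣ ↣-id ℕ) ∘↣ mk↣ {to = code} λ {z} {w} → code-injective z w
        where
        code : Refinement Y D → K × ℕ
        code z = let (k , n , _) = relevant {P = D} z in k , n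
        code-injective : ∀ z w → code z ≡ code w → z ≡ w
        code-injective z w eq = value-injective (same (relevant {P = D} z) (relevant {P = D} w) (cong proj₁ eq) (cong proj₂ eq))
          where
          same : ∀ {z w} (p : D z) (q : D w) → proj₁ p ≡ proj₁ q → proj₁ (proj₂ p) ≡ proj₁ (proj₂ q) → z ≡ w
          same (_ , _ , c , e , refl) (_ , _ , c′ , e′ , refl) refl refl with refl ← trans (sym e) e′ = refl

    isPolish : (T : Topology X) → IsComplete M → (∀ U → Open T U ⇔ MetricOpen M U) →
      {K : Set ℓ} → K ↣ ℕ → (y : K → X) → Points ⊆ closure y → IsPolish (subspace T Points)
    isPolish T M-complete open⇔ K↣ℕ y dense =
      separable T open⇔ K↣ℕ y dense , completelyMetrizable T M-complete open⇔

-- Polish covers and partitions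

module _ {a b} {A : Set a} {P : A → Set b} where

  -- Merges two countable families into one; exchanging their roles at each step gives `f 0`, `g 0`,
  -- `f 1`, `g 1` and so on.
  interleave : (ℕ → A) → (ℕ → A) → ℕ → A
  interleave f g zero = f zero
  interleave f g (ℕ.suc n) = interleave g (f ∘ ℕ.suc) n

  interleave-all : ∀ f g → (∀ n → P (f n)) → (∀ n → P (g n)) → ∀ n → P (interleave f g n)
  interleave-all f g p q zero = p zero
  interleave-all f g p q (ℕ.suc n) = interleave-all g (f ∘ ℕ.suc) q (p ∘ ℕ.suc) n

  interleave-∀ˡ : ∀ f g → (∀ n → P (interleave f g n)) → ∀ n → P (f n)
  interleave-∀ʳ : ∀ f g → (∀ n → P (interleave f g n)) → ∀ n → P (g n)
  interleave-∀ˡ f g p zero = p zero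
  interleave-∀ˡ f g p (ℕ.suc n) = interleave-∀ʳ g (f ∘ ℕ.suc) (p ∘ ℕ.suc) n
  interleave-∀ʳ f g p n = interleave-∀ˡ g (f ∘ ℕ.suc) (p ∘ ℕ.suc) n

module CompleteMetricSpace {ℓ} (em : ExcludedMiddle ℓ) {X : Set ℓ} (T : Topology X) (M : Metric X)
  (complete : IsComplete M) (open⇔ : ∀ U → Open T U ⇔ MetricOpen M U) where

  open Classical em
  open Metric M
  open MetricProperties M

  open ClosedMinusFσ em M using (Points; isPolish)

  -- An empty piece may occur under several indices; such pieces are discarded when the final
  -- partition is formed.
  record PolishPieces (B : Set ℓ) (Y : Pred X ℓ) : Set (suc ℓ) where
    field
      Index    : Set ℓ
      Index↣   : Index ↣ B
      piece    : Index → Pred X ℓ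
      polish   : ∀ i → IsPolish (subspace T (piece i))
      piece⊆   : ∀ i → piece i ⊆ Y
      cover    : ∀ {x} → x ∈ Y → ∃[ i ] x ∈ piece i
      disjoint : ∀ {i j x} → x ∈ piece i → x ∈ piece j → i ≡ j

  -- The filtration by closures of initial segments

  module ClosureFiltration {K A : Set ℓ} {_<_ : Rel A ℓ} (wo : IsWellOrder _<_) (f : K ↣ A) (y : K → X) where

    open WellOrdered wo

    Below : A → Set ℓ
    Below a = Refinement K (λ k → to f k < a)

    stage : A → Pred X ℓ
    stage a = closure {K = Below a} (y ∘ value)

    stage-closed : ∀ a → Closed (stage a)
    stage-closed a = closure-closed (y ∘ value)

    stage-mono : ∀ {a b} → a < b → stage a ⊆ stage b
    stage-mono a<b x∈ ε 0<ε = let ((k , [ k<a ]) , near) = x∈ ε 0<ε in (k , [ <-trans k<a a<b ]) , near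

    earlier : A → Pred X ℓ
    earlier a x = ∃[ b ] (b < a × x ∈ stage b)

    Cofinal : A → Set ℓ
    Cofinal a = Σ[ s ∈ (ℕ → A) ] ((∀ n → s n < a) × (∀ {b} → b < a → ∃[ n ] ¬ (s n < b)))

    -- A sequence converging to `x` is taken from stages `s n` below `a`. These are not cofinal, so
    -- a single `b < a` bounds them, and `stage b` is closed.
    earlier-closed : ∀ a → ¬ Cofinal a → Closed (earlier a)
    earlier-closed a ¬cofinal x near =
      let (b , b<a , s<b) = bound in b , b<a , stage-closed b x λ ε 0<ε →
        let (n , n≤ε) = archimedean 0<ε
        in c n , stage-mono (s<b n) (c∈ n) , dist-mono n≤ε (x~c n)
      where
      c : ℕ → X
      c n = proj₁ (near (radius n) (0<radius n))
      s : ℕ → A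
      s n = proj₁ (proj₁ (proj₂ (near (radius n) (0<radius n))))
      s<a : ∀ n → s n < a
      s<a n = proj₁ (proj₂ (proj₁ (proj₂ (near (radius n) (0<radius n)))))
      c∈ : ∀ n → c n ∈ stage (s n)
      c∈ n = proj₂ (proj₂ (proj₁ (proj₂ (near (radius n) (0<radius n)))))
      x~c : ∀ n → d x (c n) <ℚ radius n
      x~c n = proj₂ (proj₂ (near (radius n) (0<radius n)))
      bound : ∃[ b ] (b < a × (∀ n → s n < b))
      bound = stable λ unbounded → ¬cofinal (s , s<a , λ {b} b<a →
        stable λ none → unbounded (b , b<a , λ n → stable λ s≮b → none (n , s≮b)))

    earlier-Fσ : ∀ a → Σ[ E ∈ (ℕ → Pred X ℓ) ]
      ((∀ n → Closed (E n)) × (∀ n → E n ⊆ earlier a) × (∀ {x} → x ∈ earlier a → ∃[ n ] x ∈ E n))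
    earlier-Fσ a with em {P = Cofinal a}
    ... | no ¬cofinal = (λ _ → earlier a) , (λ _ → earlier-closed a ¬cofinal) , (λ _ → id) , (0 ,_)
    ... | yes (s , s<a , cofinal) = stage ∘ s , stage-closed ∘ s , (λ n x∈ → s n , s<a n , x∈) ,
      λ (b , b<a , x∈) → let (n , s≮b) = cofinal b<a in n , reach s≮b x∈
      where
      reach : ∀ {b c} → ¬ (c < b) → stage b ⊆ stage c
      reach {b} {c} c≮b x∈ with compare b c
      ... | tri< b<c _ _ = stage-mono b<c x∈
      ... | tri≈ _ refl _ = x∈
      ... | tri> _ _ c<b = contradiction c<b c≮b

    level-unique : ∀ {a b x} → x ∈ stage a → ¬ (x ∈ earlier a) → x ∈ stage b → ¬ (x ∈ earlier b) → a ≡ b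
    level-unique {a} {b} x∈a x∉a x∈b x∉b with compare a b
    ... | tri< a<b _ _ = contradiction (a , a<b , x∈a) x∉b
    ... | tri≈ _ a≡b _ = a≡b
    ... | tri> _ _ b<a = contradiction (b , b<a , x∈b) x∉a

    -- Countably many `y k` approximate `x` and their indices are bounded, so some stage contains
    -- `x`; the least such stage is taken.
    exhausts : (∀ (s : ℕ → A) → ∃[ a ] ∀ n → s n < a) → ∀ {x} → x ∈ closure y →
               ∃[ a ] (x ∈ stage a × ¬ (x ∈ earlier a))
    exhausts bounded {x} x∈ =
      let (a , x∈a , minimal) = least (λ a → x ∈ stage a) reached
      in a , x∈a , λ (b , b<a , x∈b) → minimal b<a x∈b
      where
      k : ℕ → K
      k n = proj₁ (x∈ (radius n) (0<radius n))
      reached : ∃[ a ] x ∈ stage a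
      reached =
        let (a , k<a) = bounded (to f ∘ k) in a , λ ε 0<ε →
        let (n , n≤ε) = archimedean 0<ε
        in (k n , [ k<a n ]) , dist-mono n≤ε (proj₂ (x∈ (radius n) (0<radius n)))

  -- Closed minus Fσ is the form that survives the induction: a layer intersects `C` with a closed
  -- stage and adds the sets of `earlier-Fσ` to those removed. Its dense family is indexed by a
  -- segment, which is one aleph smaller.
  polishPieces : ∀ n {B : Set ℓ} → HasCardinality-ℵ n B → {K : Set ℓ} → K ↣ B → (y : K → X) →
    (C : Pred X ℓ) (Cs : ℕ → Pred X ℓ) → Closed C → (∀ k → Closed (Cs k)) →
    Points C Cs ⊆ closure y → PolishPieces B (Points C Cs)
  polishPieces zero (lift B↔ℕ) K↣B y C Cs C-closed Cs-closed dense = record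
    { Index    = ⊤
    ; Index↣   = mk↣ {to = λ _ → to (↔⇒↣ (↔-sym B↔ℕ)) 0} λ _ → refl
    ; piece    = λ _ → Points C Cs
    ; polish   = λ _ → isPolish C Cs C-closed Cs-closed T complete open⇔ (↔⇒↣ B↔ℕ ∘↣ K↣B) y dense
    ; piece⊆   = λ _ → id
    ; cover    = _ ,_
    ; disjoint = λ _ _ → refl
    }
  polishPieces (ℕ.suc n) {A} (B , ℵB , A↣̸B , _<_ , wo , segment) {K} K↣A y C Cs C-closed Cs-closed dense = record
    { Index    = Σ A λ a → PolishPieces.Index (layers a)
    ; Index↣   = A×B↣A ∘↣ Σ-↣ (↣-id A) (λ a → PolishPieces.Index↣ (layers a))
    ; piece    = λ (a , i) → PolishPieces.piece (layers a) i
    ; polish   = λ (a , i) → PolishPieces.polish (layers a) i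
    ; piece⊆   = λ (a , i) x∈ → layer⊆ a (PolishPieces.piece⊆ (layers a) i x∈)
    ; cover    = λ x∈ →
                 let (a , x∈a , x∉a) = exhausts bounded (dense x∈)
                     (i , x∈i) = PolishPieces.cover (layers a) (layer-intro a x∈ x∈a x∉a)
                 in (a , i) , x∈i
    ; disjoint = λ {(a , i)} {(b , j)} → disjoint a b i j
    }
    where
    open Successor (aleph-infiniteCardinal n ℵB) A↣̸B wo segment using (A×B↣A; bounded)
    open ClosureFiltration wo K↣A y

    removed : A → ℕ → Pred X ℓ
    removed a = interleave {P = λ _ → ⊤ {ℓ}} Cs (proj₁ (earlier-Fσ a))

    layer : A → Pred X ℓ
    layer a = Points (C ∩ stage a) (removed a)

    below↣B : ∀ a → Below a ↣ B
    below↣B a = segment a ∘↣ mk↣ {to = λ (k , k<a) → to K↣A k , k<a} λ eq → value-injective (injective K↣A (cong value eq))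

    layers : ∀ a → PolishPieces B (layer a)
    layers a = polishPieces n ℵB (below↣B a) (y ∘ value) (C ∩ stage a) (removed a)
      (λ x near → C-closed x (λ ε 0<ε → let (c , c∈ , x~c) = near ε 0<ε in c , proj₁ c∈ , x~c) ,
                  stage-closed a x (λ ε 0<ε → let (c , c∈ , x~c) = near ε 0<ε in c , proj₂ c∈ , x~c))
      (interleave-all {P = Closed} Cs _ Cs-closed (proj₁ (proj₂ (earlier-Fσ a))))
      -- Density is immediate, as `stage a` is by definition the closure of the points indexed by
      -- `Below a`.
      (λ ((_ , x∈a) , _) → x∈a)

    layer⊆ : ∀ a → layer a ⊆ Points C Cs
    layer⊆ a {x} ((x∈C , _) , x∉) = x∈C , interleave-∀ˡ {P = x ∉_} Cs _ x∉

    layer⇒∉earlier : ∀ a {x} → x ∈ layer a → ¬ (x ∈ earlier a)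
    layer⇒∉earlier a {x} (_ , x∉) x∈ =
      let (n , x∈n) = proj₂ (proj₂ (proj₂ (earlier-Fσ a))) x∈ in interleave-∀ʳ {P = x ∉_} Cs _ x∉ n x∈n

    layer-intro : ∀ a {x} → x ∈ Points C Cs → x ∈ stage a → ¬ (x ∈ earlier a) → x ∈ layer a
    layer-intro a {x} (x∈C , x∉Cs) x∈a x∉a = (x∈C , x∈a) ,
      interleave-all {P = x ∉_} Cs _ x∉Cs (λ n x∈n → x∉a (proj₁ (proj₂ (proj₂ (earlier-Fσ a))) n x∈n))

    disjoint : ∀ a b i j {x} → x ∈ PolishPieces.piece (layers a) i → x ∈ PolishPieces.piece (layers b) j →
               _≡_ {A = Σ A λ a → PolishPieces.Index (layers a)} (a , i) (b , j)
    disjoint a b i j x∈i x∈j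
      with x∈a ← PolishPieces.piece⊆ (layers a) i x∈i | x∈b ← PolishPieces.piece⊆ (layers b) j x∈j
      with refl ← level-unique (proj₂ (proj₁ x∈a)) (layer⇒∉earlier a x∈a) (proj₂ (proj₁ x∈b)) (layer⇒∉earlier b x∈b)
      = cong (a ,_) (PolishPieces.disjoint (layers a) x∈i x∈j)

  -- Weight, the lower bound for covers, and the final partition

  module Weight {n : ℕ} {A B : Set ℓ} (ℵB : HasCardinality-ℵ n B) (A↣̸B : ¬ (A ↣ B))
    {_<_ : Rel A ℓ} (wo : IsWellOrder _<_) (segment : ∀ a → Refinement A (λ x → x < a) ↣ B)
    {G-Index : Set ℓ} (G-Index↔A : G-Index ↔ A) (G : G-Index → Pred X ℓ) (G-basis : IsBasis T G)
    (minimal : ∀ (I : Set ℓ) (F : I → Pred X ℓ) → Distinct F → IsBasis T F → A ↣ I) where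

    private
      module B = InfiniteCardinal (aleph-infiniteCardinal n ℵB)

      Nonempty : Set ℓ
      Nonempty = Refinement G-Index (Satisfiable ∘ G)

      Nonempty↣A : Nonempty ↣ A
      Nonempty↣A = restrict-↣ (↔⇒↣ G-Index↔A)

      point : Nonempty → X
      point i = proj₁ (relevant {P = Satisfiable ∘ G} i)

      point-dense : ∀ U → Open T U → Satisfiable U → ∃[ i ] point i ∈ U
      point-dense U U-open (x , x∈U) =
        let (i , x∈i , Gi⊆U) = proj₂ G-basis U U-open x x∈U
            -- The point recomputed from `i′` need not be `x`, but it also lies in `G i`.
            i′ = i , [ (x , x∈i) ]
        in i′ , Gi⊆U (proj₂ (relevant {P = Satisfiable ∘ G} i′))

    -- Balls with radii `radius n` around a dense family indexed by `P` would form a basis indexed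
    -- within `P × ℕ`, hence within `B`, contradicting the minimality of `A`.
    small-not-dense : {P : Set ℓ} → P ↣ B → (p : P → X) →
                      ¬ (∀ U → Open T U → Satisfiable U → ∃[ i ] p i ∈ U)
    small-not-dense {P} P↣B p dense = A↣̸B (restrict-↣ P×ℕ↣B ∘↣
      minimal (Refinement (P × ℕ) (FirstOccurrence ball)) (ball ∘ value)
        (firstOccurrences-distinct ball) ((λ i → ball-isOpen (value i)) , basis))
      where
      P×ℕ↣B : (P × ℕ) ↣ B
      P×ℕ↣B = B.square ∘↣ (P↣B ×-↣ B.ℕ↣)
      -- `minimal` requires a family without repetitions; this order selects the first occurrence of
      -- each ball.
      open WellOrdered (pullback P×ℕ↣B B.isWellOrder)
      ball : P × ℕ → Pred X ℓ
      ball (i , n) x = Lift ℓ (d (p i) x <ℚ radius n)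
      ball-isOpen : ∀ i → Open T (ball i)
      ball-isOpen (i , n) = Equivalence.from (open⇔ _) (ball-open (p i) (radius n))
      basis : ∀ U → Open T U → ∀ x → x ∈ U → ∃[ i ] (x ∈ ball (value {P = FirstOccurrence ball} i) × ball (value i) ⊆ U)
      basis U U-open x x∈U =
        let (ε , 0<ε , near⊆U) = Equivalence.to (open⇔ U) U-open x x∈U
            (n , n≤) = archimedean (0<half 0<ε)
            (i , lift x~i) = dense (λ z → Lift ℓ (d x z <ℚ radius n))
              (Equivalence.from (open⇔ _) (ball-open x (radius n))) (x , lift (dist-refl (0<radius n)))
            (j , (j⊆i , i⊆j) , first) = firstOccurrence ball (i , n)
        in (j , [ first ]) , i⊆j (lift (dist-sym x~i)) , λ {z} z∈ →
           near⊆U z (dist-halves (dist-mono n≤ x~i) (dist-mono n≤ (lower (j⊆i z∈))))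

    -- Only members chosen to contain some `point j` are kept, so that `Used` inherits a well-order
    -- from `A`. Were it smaller than `A`, the countable dense subsets of these members would
    -- together form a dense family indexed within `B`.
    cover-≥ : ∀ (I : Set ℓ) (F : I → Pred X ℓ) → IsPolishCover T F → A ↣ I
    cover-≥ I F (F-polish , F-cover) =
      [ (λ A↣Used → mk↣ value-injective ∘↣ A↣Used)
      , (λ (a , Used↣a) → contradiction dense (small-not-dense
          (B.square ∘↣ (↣-id B ×-↣ B.ℕ↣) ∘↣ Σ-↣ (segment a ∘↣ Used↣a) (λ i → proj₂ (proj₂ (separable (value i)))))
          (λ (_ , z) → value (value z)))) ]′ (compare-↣ wo (pullback Used↣A wo))
      where
      home : Nonempty → I
      home i = proj₁ (F-cover (point i))
      Used : Set ℓ
      Used = Refinement I λ i → ∃[ j ] home j ≡ i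
      Used↣A : Used ↣ A
      Used↣A = Nonempty↣A ∘↣ mk↣ {to = λ i → proj₁ (origin i)} λ {i} {i′} eq →
        value-injective (trans (sym (proj₂ (origin i))) (trans (cong home eq) (proj₂ (origin i′))))
        where
        origin : ∀ (i : Used) → ∃[ j ] home j ≡ value i
        origin = relevant
      separable : ∀ i → Separable (subspace T (F i))
      separable i = proj₁ (F-polish i)
      dense : ∀ U → Open T U → Satisfiable U →
        ∃[ q ] value {P = F (value (proj₁ q))} (value {P = proj₁ (separable (value (proj₁ q)))} (proj₂ {A = Used} q)) ∈ U
      dense U U-open U-nonempty =
        let (j , j∈U) = point-dense U U-open U-nonempty
            -- `U` contains `point j`, so its trace on the member `F (home j)` is nonempty and
            -- relatively open.
            (z , z∈D , z∈U) = proj₁ (proj₂ (separable (home j))) (U ∘ value) (U , U-open , id , id)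
              ((point j , [ proj₂ (F-cover (point j)) ]) , j∈U)
        in ((home j , [ (j , refl) ]) , (z , [ z∈D ])) , z∈U

    -- The construction bounds the number of pieces above by `A`; a partition is also a cover, so
    -- `cover-≥` bounds it below.
    polishPartition : Σ[ I ∈ Set ℓ ] (I ↔ A) × (Σ[ F ∈ (I → Pred X ℓ) ] Distinct F × IsPolishPartition T F)
    polishPartition = I , schröder-bernstein I↣A (cover-≥ I F (F-polish , F-cover)) , F ,
      F-distinct , (F-polish , F-cover) , λ i≢j _ (x∈i , x∈j) → i≢j (value-injective (disjoint x∈i x∈j))
      where
      dense : Points (λ _ → ⊤) (λ _ _ → ⊥) ⊆ closure point
      dense {x} _ ε 0<ε =
        let (i , lift x~i) = point-dense _ (Equivalence.from (open⇔ _) (ball-open x ε)) (x , lift (dist-refl 0<ε))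
        in i , x~i
      pieces : PolishPieces A (Points (λ _ → ⊤) (λ _ _ → ⊥))
      -- The whole space is the closed set `X` minus countably many copies of the empty set.
      pieces = polishPieces (ℕ.suc n) (B , ℵB , A↣̸B , _<_ , wo , segment) Nonempty↣A point (λ _ → ⊤) (λ _ _ → ⊥)
        (λ _ _ → _) (λ _ _ near → proj₁ (proj₂ (near 1ℚ (ℚₚ.positive⁻¹ 1ℚ)))) dense
      open PolishPieces pieces
      I : Set ℓ
      -- Discarding empty pieces makes the remaining disjoint pieces pairwise distinct.
      I = Refinement Index (Satisfiable ∘ piece)
      I↣A : I ↣ A
      I↣A = restrict-↣ Index↣
      F : I → Pred X ℓ
      F = piece ∘ value
      F-polish : ∀ i → IsPolish (subspace T (F i))
      F-polish = polish ∘ value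
      F-cover : ∀ x → ∃[ i ] x ∈ F i
      F-cover x = let (i , x∈i) = cover {x} (_ , λ _ ()) in (i , [ (x , x∈i) ]) , x∈i
      F-distinct : Distinct F
      F-distinct {i} {j} (Fi⊆Fj , _) =
        let (x , x∈i) = relevant {P = Satisfiable ∘ piece} i
        in value-injective (disjoint x∈i (Fi⊆Fj x∈i))

theorem2p5 : ∀ {ℓ : Level} → ExcludedMiddle (suc ℓ) →
    (X : Set ℓ) (T : Topology X) → CompletelyMetrizable T →
    (n : ℕ) → .{{NonZero n}} →
    (ℵₙ : Set ℓ) → HasCardinality-ℵ n ℵₙ →
    WeightIs T ℵₙ →
    CovIs T ℵₙ × ParIs T ℵₙ
theorem2p5 {ℓ} em X T (M , complete , open⇔) (ℕ.suc n) A (B , ℵB , A↣̸B , _<_ , wo , segment)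
  ((_ , G-Index↔A , G , _ , G-basis) , minimal) =
  ( (I , I↔A , F , F-distinct , proj₁ F-partition) , λ J F′ _ → cover-≥ J F′ ) ,
  ( (I , I↔A , F , F-distinct , F-partition) , λ J F′ _ F′-partition → cover-≥ J F′ (proj₁ F′-partition) )
  where
  open CompleteMetricSpace {ℓ} (map′ lower lift (em {P = Lift (suc ℓ) _})) T M complete open⇔
  open Weight ℵB A↣̸B wo segment G-Index↔A G G-basis minimal
  I : Set ℓ
  I = proj₁ polishPartition
  I↔A : I ↔ A
  I↔A = proj₁ (proj₂ polishPartition)
  F : I → Pred X ℓ
  F = proj₁ (proj₂ (proj₂ polishPartition))
  F-distinct : Distinct F
  F-distinct = proj₁ (proj₂ (proj₂ (proj₂ polishPartition)))
  F-partition : IsPolishPartition T F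
  F-partition = proj₂ (proj₂ (proj₂ (proj₂ polishPartition)))
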